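{- For every formula $\varphi$ of intuitionistic propositional logic, $\varphi$ is algebraically valid (true in every algebraic model) if and only if $\varphi$ is Kripke valid (true at every world of every Kripke model).
   Context: Formulas: built from a countable set of propositional variables indexed by natural numbers ($Var=\{p_n : n\in\mathbb{N}\}$) and $\bot$ by the binary connectives $\wedge,\vee,\to$. Kripke semantics: a Kripke model is $M=(W,R,V)$ with $W$ a non-empty set, $R$ a reflexive and transitive binary relation on $W$, and $V:Var\times W\to\{0,1\}$ such that $V(p,w)=1$ and $Rww'$ imply $V(p,w')=1$. Truth at a world: $M,w\vDash p$ iff $V(p,w)=1$; $M,w\not\vDash\bot$; $M,w\vDash\varphi\wedge\psi$ iff both hold at $w$; $M,w\vDash\varphi\vee\psi$ iff at least one holds at $w$; $M,w\vDash\varphi\to\psi$ iff for all $w'$ with $Rww'$ and $M,w'\vDash\varphi$ one has $M,w'\vDash\psi$. $\varphi$ is Kripke valid if $M,w\vDash\varphi$ for all Kripke models $M$ and all worlds $w$ of $M$. Algebraic semantics: a Heyting algebra $H$ is a bounded lattice (least element $0$, greatest element $1$) with an operation $\to$ such that $a\le b\to c$ iff $a\wedge b\le c$. An algebraic interpretation in $H$ is a function $I$ from formulas to $H$ with $I(\bot)=0$, $I(\varphi\wedge\psi)=I(\varphi)\wedge I(\psi)$, $I(\varphi\vee\psi)=I(\varphi)\vee I(\psi)$, $I(\varphi\to\psi)=I(\varphi)\to I(\psi)$. $\varphi$ is algebraically valid if $I(\varphi)=1$ for every Heyting algebra $H$ and every algebraic interpretation $I$ in $H$. -}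

module Defs where

open import Data.Bool using (Bool; true)
open import Data.Empty.Polymorphic using () renaming (⊥ to Empty)
open import Data.Nat using (ℕ)
open import Data.Product using (_×_)
open import Data.Sum using (_⊎_)
open import Level using (Level; Lift; suc; _⊔_)
open import Relation.Binary.Core using (Rel)
open import Relation.Binary.Definitions using (Reflexive; Transitive)
open import Relation.Binary.Lattice.Bundles using (HeytingAlgebra)
open import Relation.Binary.PropositionalEquality using (_≡_)

infixr 7 _∧′_
infixr 6 _∨′_
infixr 5 _⇒′_

data Formula : Set where
  var  : ℕ → Formula
  ⊥′   : Formula
  _∧′_ : Formula → Formula → Formula
  _∨′_ : Formula → Formula → Formula
  _⇒′_ : Formula → Formula → Formula

record KripkeModel (w r : Level) : Set (suc (w ⊔ r)) where
  field
    W          : Set w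
    point      : W  -- W is non-empty
    R          : Rel W r
    reflexive  : Reflexive R
    transitive : Transitive R
    V          : ℕ → W → Bool
    monotone   : ∀ p {x y} → V p x ≡ true → R x y → V p y ≡ true

infix 4 _,_⊨_

_,_⊨_ : ∀ {w r} (M : KripkeModel w r) → KripkeModel.W M → Formula → Set (w ⊔ r)
_,_⊨_ {w} {r} M x (var p) = Lift (w ⊔ r) (KripkeModel.V M p x ≡ true)
M , x ⊨ ⊥′       = Empty
M , x ⊨ (φ ∧′ ψ) = (M , x ⊨ φ) × (M , x ⊨ ψ)
M , x ⊨ (φ ∨′ ψ) = (M , x ⊨ φ) ⊎ (M , x ⊨ ψ)
M , x ⊨ (φ ⇒′ ψ) = ∀ y → KripkeModel.R M x y → M , y ⊨ φ → M , y ⊨ ψ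

KripkeValid : (w r : Level) → Formula → Set (suc (w ⊔ r))
KripkeValid w r φ = (M : KripkeModel w r) (x : KripkeModel.W M) → M , x ⊨ φ

record IsInterpretation {c ℓ₁ ℓ₂} (H : HeytingAlgebra c ℓ₁ ℓ₂)
                        (I : Formula → HeytingAlgebra.Carrier H) : Set ℓ₁ where
  open HeytingAlgebra H using (_≈_; _∧_; _∨_; _⇨_; ⊥)
  field
    ⊥-homo : I ⊥′ ≈ ⊥
    ∧-homo : ∀ φ ψ → I (φ ∧′ ψ) ≈ (I φ ∧ I ψ)
    ∨-homo : ∀ φ ψ → I (φ ∨′ ψ) ≈ (I φ ∨ I ψ)
    ⇒-homo : ∀ φ ψ → I (φ ⇒′ ψ) ≈ (I φ ⇨ I ψ)

AlgebraicallyValid : (c ℓ₁ ℓ₂ : Level) → Formula → Set (suc (c ⊔ ℓ₁ ⊔ ℓ₂))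
AlgebraicallyValid c ℓ₁ ℓ₂ φ =
  (H : HeytingAlgebra c ℓ₁ ℓ₂) (let open HeytingAlgebra H using (Carrier; _≈_; ⊤)) →
  (I : Formula → Carrier) → IsInterpretation H I → I φ ≈ ⊤

{-# OPTIONS --safe #-}

-- Both semantics are compared with provability, where φ ⊑ ψ is the order of the
-- free Heyting algebra on the variables: algebraic validity of φ yields ⊤′ ⊑ φ
-- in the free algebra itself, and soundness is an induction on ⊑.  For Kripke
-- completeness to hold constructively and with Bool-valued valuations, provability is decided:
-- given finite sets Γ and Δ of subformulas of φ, cuts on all the subformulas
-- either prove ⋀ Γ ⊑ ⋁ Δ or extend (Γ, Δ) to a Hintikka pair.  A refuted implication
-- a ⇒′ b with a ∉ Γ asks for a new pair above Γ with a on its left, so that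
-- this process ends, and the Hintikka pairs form a Kripke model.

module Submission where

open import Defs
open import Level using (Level; Lift; lift; lower)
open import Function.Bundles using (_⇔_; mk⇔)

open import Data.Bool using (true)
open import Data.Empty using (⊥; ⊥-elim)
import Data.Empty.Polymorphic as Poly
open import Data.List using (List; []; _∷_; _++_; foldr; filter; length; [_])
open import Data.List.Membership.Propositional using (_∈_; lose)
open import Data.List.Membership.Propositional.Properties
  using (∈-++⁺ˡ; ∈-++⁺ʳ; ∈-++⁻; ∈-filter⁺)
import Data.List.Membership.DecPropositional as DecMembership
open import Data.List.Properties using (filter-notAll)
open import Data.List.Relation.Binary.Subset.Propositional using (_⊆_)
open import Data.List.Relation.Binary.Subset.Propositional.Properties using (∈-∷⁺ʳ)
open import Data.List.Relation.Unary.All using (All; []; _∷_) renaming (lookup to lookupAll)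
open import Data.List.Relation.Unary.Any using (here; there)
open import Data.Nat using (_<_) renaming (_≟_ to _≟ℕ_)
open import Data.Nat.Induction using (<-wellFounded)
open import Data.Product using (_×_; _,_; proj₁; proj₂; ∃₂; swap)
open import Data.Sum as Sum using (_⊎_; inj₁; inj₂; [_,_]′)
open import Data.Unit using (⊤)
open import Function using (_∘_; id)
open import Induction.WellFounded using (Acc; acc)
open import Relation.Binary.Definitions using (DecidableEquality)
open import Relation.Binary.Lattice.Bundles using (HeytingAlgebra)
open import Relation.Binary.PropositionalEquality using (_≡_; refl; sym; cong; cong₂; subst)
open import Relation.Nullary using (¬_; Dec; yes; no; does; proof; Reflects; invert)
open import Relation.Nullary.Decidable using (map′; _×-dec_; ¬?; dec-true)

private
  variable
    a b d χ : Formula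
    Γ Δ : List Formula

-- Provability

infix 4 _⊑_ _⊢_

data _⊑_ : Formula → Formula → Set where
  ⊑-refl  : a ⊑ a
  ⊑-trans : a ⊑ b → b ⊑ d → a ⊑ d
  ⊥-min   : ⊥′ ⊑ a
  ∧-fst   : a ∧′ b ⊑ a
  ∧-snd   : a ∧′ b ⊑ b
  ∧-pair  : d ⊑ a → d ⊑ b → d ⊑ a ∧′ b
  ∨-inl   : a ⊑ a ∨′ b
  ∨-inr   : b ⊑ a ∨′ b
  ∨-case  : a ⊑ d → b ⊑ d → a ∨′ b ⊑ d
  curry   : d ∧′ a ⊑ b → d ⊑ a ⇒′ b
  uncurry : d ⊑ a ⇒′ b → d ∧′ a ⊑ b

⊤′ : Formula
⊤′ = ⊥′ ⇒′ ⊥′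

⊤-max : a ⊑ ⊤′
⊤-max = curry ∧-snd

-- The free Heyting algebra and algebraic completeness

freeHeytingAlgebra : (c ℓ₁ ℓ₂ : Level) → HeytingAlgebra c ℓ₁ ℓ₂
freeHeytingAlgebra c ℓ₁ ℓ₂ = record
  { Carrier = Lift c Formula
  -- Equality is interderivability, so the formulas themselves carry the algebra without a quotient.
  ; _≈_ = λ (lift a) (lift b) → Lift ℓ₁ (a ⊑ b × b ⊑ a)
  ; _≤_ = λ (lift a) (lift b) → Lift ℓ₂ (a ⊑ b)
  ; _∨_ = λ (lift a) (lift b) → lift (a ∨′ b)
  ; _∧_ = λ (lift a) (lift b) → lift (a ∧′ b)
  ; _⇨_ = λ (lift a) (lift b) → lift (a ⇒′ b)
  ; ⊤ = lift ⊤′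
  ; ⊥ = lift ⊥′
  ; isHeytingAlgebra = record
    { isBoundedLattice = record
      { isLattice = record
        { isPartialOrder = record
          { isPreorder = record
            { isEquivalence = record
              { refl  = lift (⊑-refl , ⊑-refl)
              ; sym   = λ (lift p) → lift (swap p)
              ; trans = λ (lift (p , p′)) (lift (q , q′)) →
                  lift (⊑-trans p q , ⊑-trans q′ p′)
              }
            ; reflexive = λ (lift (p , _)) → lift p
            ; trans     = λ (lift p) (lift q) → lift (⊑-trans p q)
            }
          ; antisym = λ (lift p) (lift q) → lift (p , q)
          }
        ; supremum = λ _ _ → lift ∨-inl , lift ∨-inr , λ _ (lift p) (lift q) → lift (∨-case p q)
        ; infimum  = λ _ _ → lift ∧-fst , lift ∧-snd , λ _ (lift p) (lift q) → lift (∧-pair p q)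
        }
      ; maximum = λ _ → lift ⊤-max
      ; minimum = λ _ → lift ⊥-min
      }
    ; exponential = λ _ _ _ → (λ (lift p) → lift (curry p)) , (λ (lift p) → lift (uncurry p))
    }
  }

algebraicCompleteness : ∀ {c ℓ₁ ℓ₂} φ → AlgebraicallyValid c ℓ₁ ℓ₂ φ → ⊤′ ⊑ φ
algebraicCompleteness {c} {ℓ₁} {ℓ₂} φ valid =
  -- The tautological interpretation `lift` is a homomorphism by reflexivity; one half of the
  -- resulting equality with truth is the derivation sought.
  proj₂ (lower (valid H lift record
    { ⊥-homo = Eq.refl
    ; ∧-homo = λ _ _ → Eq.refl
    ; ∨-homo = λ _ _ → Eq.refl
    ; ⇒-homo = λ _ _ → Eq.refl
    }))
  where
  H = freeHeytingAlgebra c ℓ₁ ℓ₂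
  open HeytingAlgebra H using (module Eq)

-- Algebraic soundness

module _ {c ℓ₁ ℓ₂} (H : HeytingAlgebra c ℓ₁ ℓ₂) where
  open HeytingAlgebra H renaming (⊤ to 𝟏; refl to ≤-refl)

  module _ {I : Formula → Carrier} (isInterpretation : IsInterpretation H I) where
    open IsInterpretation isInterpretation

    interpretation-monotone : a ⊑ b → I a ≤ I b
    interpretation-monotone ⊑-refl = ≤-refl
    interpretation-monotone (⊑-trans p q) =
      trans (interpretation-monotone p) (interpretation-monotone q)
    interpretation-monotone ⊥-min = trans (reflexive ⊥-homo) (minimum _)
    interpretation-monotone ∧-fst = trans (reflexive (∧-homo _ _)) (x∧y≤x _ _)
    interpretation-monotone ∧-snd = trans (reflexive (∧-homo _ _)) (x∧y≤y _ _)
    interpretation-monotone (∧-pair p q) =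
      trans (∧-greatest (interpretation-monotone p) (interpretation-monotone q))
            (reflexive (Eq.sym (∧-homo _ _)))
    interpretation-monotone ∨-inl = trans (x≤x∨y _ _) (reflexive (Eq.sym (∨-homo _ _)))
    interpretation-monotone ∨-inr = trans (y≤x∨y _ _) (reflexive (Eq.sym (∨-homo _ _)))
    interpretation-monotone (∨-case p q) =
      trans (reflexive (∨-homo _ _))
            (∨-least (interpretation-monotone p) (interpretation-monotone q))
    interpretation-monotone (curry p) =
      trans (transpose-⇨ (trans (reflexive (Eq.sym (∧-homo _ _))) (interpretation-monotone p)))
            (reflexive (Eq.sym (⇒-homo _ _)))
    interpretation-monotone (uncurry p) =
      trans (reflexive (∧-homo _ _))
            (transpose-∧ (trans (interpretation-monotone p) (reflexive (⇒-homo _ _))))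

    -- Interpretations have no clause for truth, but `⊤′` is an implication with equal sides, which
    -- is top in any Heyting algebra.
    𝟏≤I⊤′ : 𝟏 ≤ I ⊤′
    𝟏≤I⊤′ = trans (transpose-⇨ (x∧y≤y _ _)) (reflexive (Eq.sym (⇒-homo _ _)))

    algebraicSoundness : ∀ φ → ⊤′ ⊑ φ → I φ ≈ 𝟏
    algebraicSoundness φ p = antisym (maximum _) (trans 𝟏≤I⊤′ (interpretation-monotone p))

-- Persistence and Kripke soundness

module _ {w r} (M : KripkeModel w r) where
  open KripkeModel M

  persistent : ∀ φ {x y} → R x y → M , x ⊨ φ → M , y ⊨ φ
  persistent (var p)  Rxy (lift v)   = lift (monotone p v Rxy)
  persistent (φ ∧′ ψ) Rxy (⊨φ , ⊨ψ) = persistent φ Rxy ⊨φ , persistent ψ Rxy ⊨ψ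
  persistent (φ ∨′ ψ) Rxy (inj₁ ⊨φ) = inj₁ (persistent φ Rxy ⊨φ)
  persistent (φ ∨′ ψ) Rxy (inj₂ ⊨ψ) = inj₂ (persistent ψ Rxy ⊨ψ)
  persistent (φ ⇒′ ψ) Rxy ⊨φ⇒ψ     = λ z Ryz → ⊨φ⇒ψ z (transitive Rxy Ryz)

  ⊨-monotone : a ⊑ b → ∀ {x} → M , x ⊨ a → M , x ⊨ b
  ⊨-monotone ⊑-refl        = id
  ⊨-monotone (⊑-trans p q) = ⊨-monotone q ∘ ⊨-monotone p
  ⊨-monotone ⊥-min         = Poly.⊥-elim
  ⊨-monotone ∧-fst         = proj₁
  ⊨-monotone ∧-snd         = proj₂
  ⊨-monotone (∧-pair p q)  = λ ⊨d → ⊨-monotone p ⊨d , ⊨-monotone q ⊨d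
  ⊨-monotone ∨-inl         = inj₁
  ⊨-monotone ∨-inr         = inj₂
  ⊨-monotone (∨-case p q)  = [ ⊨-monotone p , ⊨-monotone q ]′
  -- `d` is known at `x` while `a` becomes true only at `y`, so persistence carries `d` along.
  ⊨-monotone (curry {d} p) = λ ⊨d y Rxy ⊨a → ⊨-monotone p (persistent d Rxy ⊨d , ⊨a)
  ⊨-monotone (uncurry p)   = λ (⊨d , ⊨a) → ⊨-monotone p ⊨d _ reflexive ⊨a

kripkeSoundness : ∀ {w r} φ → ⊤′ ⊑ φ → KripkeValid w r φ
kripkeSoundness φ p M x = ⊨-monotone M p (λ _ _ → id)

-- Sequents

⋀ ⋁ : List Formula → Formula
⋀ = foldr _∧′_ ⊤′
⋁ = foldr _∨′_ ⊥′

_⊢_ : List Formula → List Formula → Set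
Γ ⊢ Δ = ⋀ Γ ⊑ ⋁ Δ

⋀-lower : a ∈ Γ → ⋀ Γ ⊑ a
⋀-lower (here refl) = ∧-fst
⋀-lower (there a∈Γ) = ⊑-trans ∧-snd (⋀-lower a∈Γ)

⋁-upper : a ∈ Δ → a ⊑ ⋁ Δ
⋁-upper (here refl) = ∨-inl
⋁-upper (there a∈Δ) = ⊑-trans (⋁-upper a∈Δ) ∨-inr

⊢-via : a ∈ Γ → a ⊑ b → b ∈ Δ → Γ ⊢ Δ
⊢-via a∈Γ a⊑b b∈Δ = ⊑-trans (⋀-lower a∈Γ) (⊑-trans a⊑b (⋁-upper b∈Δ))

∧-swap : a ∧′ b ⊑ b ∧′ a
∧-swap = ∧-pair ∧-snd ∧-fst

modusPonens : d ⊑ a ⇒′ b → d ⊑ a → d ⊑ b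
modusPonens p q = ⊑-trans (∧-pair ⊑-refl q) (uncurry p)

-- Both disjuncts of `a ∨′ ⋁ Δ` lie below `⋀ Γ ⇒′ ⋁ Δ`; residuation thus does the work of
-- distributivity.
cut : a ∷ Γ ⊢ Δ → Γ ⊢ a ∷ Δ → Γ ⊢ Δ
cut a,Γ⊢Δ Γ⊢a,Δ = modusPonens (⊑-trans Γ⊢a,Δ (∨-case (curry a,Γ⊢Δ) (curry ∧-fst))) ⊑-refl

-- Only `b` stands on the right of the premise. This intuitionistic restriction is why a refuted
-- implication may need a second pair.
⇒-right : a ⇒′ b ∈ Δ → a ∷ Γ ⊢ [ b ] → Γ ⊢ Δ
⇒-right a⇒b∈Δ a,Γ⊢b =
  ⊑-trans (curry (⊑-trans ∧-swap (⊑-trans a,Γ⊢b (∨-case ⊑-refl ⊥-min)))) (⋁-upper a⇒b∈Δ)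

-- Subformulas

infix 4 _≟_

_≟_ : DecidableEquality Formula
var m    ≟ var n    = map′ (cong var) (λ { refl → refl }) (m ≟ℕ n)
var _    ≟ ⊥′       = no λ ()
var _    ≟ _ ∧′ _   = no λ ()
var _    ≟ _ ∨′ _   = no λ ()
var _    ≟ _ ⇒′ _   = no λ ()
⊥′       ≟ var _    = no λ ()
⊥′       ≟ ⊥′       = yes refl
⊥′       ≟ _ ∧′ _   = no λ ()
⊥′       ≟ _ ∨′ _   = no λ ()
⊥′       ≟ _ ⇒′ _   = no λ ()
_ ∧′ _   ≟ var _    = no λ ()
_ ∧′ _   ≟ ⊥′       = no λ ()
(a ∧′ b) ≟ (c ∧′ d) =
  map′ (λ (p , q) → cong₂ _∧′_ p q) (λ { refl → refl , refl }) (a ≟ c ×-dec b ≟ d)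
_ ∧′ _   ≟ _ ∨′ _   = no λ ()
_ ∧′ _   ≟ _ ⇒′ _   = no λ ()
_ ∨′ _   ≟ var _    = no λ ()
_ ∨′ _   ≟ ⊥′       = no λ ()
_ ∨′ _   ≟ _ ∧′ _   = no λ ()
(a ∨′ b) ≟ (c ∨′ d) =
  map′ (λ (p , q) → cong₂ _∨′_ p q) (λ { refl → refl , refl }) (a ≟ c ×-dec b ≟ d)
_ ∨′ _   ≟ _ ⇒′ _   = no λ ()
_ ⇒′ _   ≟ var _    = no λ ()
_ ⇒′ _   ≟ ⊥′       = no λ ()
_ ⇒′ _   ≟ _ ∧′ _   = no λ ()
_ ⇒′ _   ≟ _ ∨′ _   = no λ ()
(a ⇒′ b) ≟ (c ⇒′ d) =
  map′ (λ (p , q) → cong₂ _⇒′_ p q) (λ { refl → refl , refl }) (a ≟ c ×-dec b ≟ d)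

open DecMembership _≟_ using (_∈?_)

subformulas : Formula → List Formula
properSubformulas : Formula → List Formula
subformulas φ = φ ∷ properSubformulas φ
properSubformulas (var _)  = []
properSubformulas ⊥′       = []
properSubformulas (a ∧′ b) = subformulas a ++ subformulas b
properSubformulas (a ∨′ b) = subformulas a ++ subformulas b
properSubformulas (a ⇒′ b) = subformulas a ++ subformulas b

subformulas-trans : ∀ φ → χ ∈ subformulas φ → properSubformulas χ ⊆ subformulas φ
subformulas-trans₂ : ∀ φ ψ → χ ∈ subformulas φ ++ subformulas ψ →
                     properSubformulas χ ⊆ subformulas φ ++ subformulas ψ

subformulas-trans φ        (here refl) = there
subformulas-trans (a ∧′ b) (there χ∈)  = there ∘ subformulas-trans₂ a b χ∈
subformulas-trans (a ∨′ b) (there χ∈)  = there ∘ subformulas-trans₂ a b χ∈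
subformulas-trans (a ⇒′ b) (there χ∈)  = there ∘ subformulas-trans₂ a b χ∈

subformulas-trans₂ φ ψ χ∈ with ∈-++⁻ (subformulas φ) χ∈
... | inj₁ χ∈φ = ∈-++⁺ˡ ∘ subformulas-trans φ χ∈φ
... | inj₂ χ∈ψ = ∈-++⁺ʳ (subformulas φ) ∘ subformulas-trans ψ χ∈ψ

-- Hintikka pairs

-- The clause for `a ⇒′ b` can be local: left sides grow along the order of the model, so the
-- implication meets the same clause at every later pair.
LeftCondition : List Formula → List Formula → Formula → Set
LeftCondition Γ Δ (var p)  = ¬ var p ∈ Δ
LeftCondition Γ Δ ⊥′       = ⊥
LeftCondition Γ Δ (a ∧′ b) = a ∈ Γ × b ∈ Γ
LeftCondition Γ Δ (a ∨′ b) = a ∈ Γ ⊎ b ∈ Γ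
LeftCondition Γ Δ (a ⇒′ b) = a ∈ Δ ⊎ b ∈ Γ

-- For a ⇒′ b the pair may be its own witness; this case is kept apart because
-- Hintikka is defined inductively.
RightCondition : (List Formula → List Formula → Set) →
                 List Formula → List Formula → Formula → Set
RightCondition H Γ Δ (var p)  = ⊤
RightCondition H Γ Δ ⊥′       = ⊤
RightCondition H Γ Δ (a ∧′ b) = a ∈ Δ ⊎ b ∈ Δ
RightCondition H Γ Δ (a ∨′ b) = a ∈ Δ × b ∈ Δ
RightCondition H Γ Δ (a ⇒′ b) =
  (a ∈ Γ × b ∈ Δ) ⊎ ∃₂ λ Γ′ Δ′ → H Γ′ Δ′ × a ∷ Γ ⊆ Γ′ × [ b ] ⊆ Δ′

-- A proof contains the proofs for the pairs that witness refuted implications, so the search can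
-- build it with no prior collection of worlds.
data Hintikka (Γ Δ : List Formula) : Set where
  hintikka : All (LeftCondition Γ Δ) Γ → All (RightCondition Hintikka Γ Δ) Δ → Hintikka Γ Δ

HintikkaExtension : List Formula → List Formula → Set
HintikkaExtension Γ Δ = ∃₂ λ Γ′ Δ′ → Hintikka Γ′ Δ′ × Γ ⊆ Γ′ × Δ ⊆ Δ′

all-or : ∀ {A Q : Set} {P : A → Set} (xs : List A) →
         (∀ {x} → x ∈ xs → Q ⊎ P x) → Q ⊎ All P xs
all-or []       f = inj₂ []
all-or (x ∷ xs) f with f (here refl) | all-or xs (f ∘ there)
... | inj₁ q | _       = inj₁ q
... | inj₂ _ | inj₁ q  = inj₁ q
... | inj₂ p | inj₂ ps = inj₂ (p ∷ ps)

-- Deciding provability by saturation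

module _ (φ : Formula) where

  private
    S = subformulas φ

  components : properSubformulas χ ≡ subformulas a ++ subformulas b → χ ∈ S → a ∈ S × b ∈ S
  components {a = a} eq χ∈S = below (here refl) , below (∈-++⁺ʳ (subformulas a) (here refl))
    where
    below : subformulas a ++ subformulas _ ⊆ S
    below = subformulas-trans φ χ∈S ∘ subst (_ ∈_) (sym eq)

  module _ (Γ⊆S : Γ ⊆ S) (Δ⊆S : Δ ⊆ S) (total : ∀ {χ} → χ ∈ S → χ ∈ Γ ⊎ χ ∈ Δ) where

    -- Every subformula has a side, so when the condition fails the components of `χ` stand where
    -- one rule for its connective derives `Γ ⊢ Δ`.
    prove-or-leftCondition : χ ∈ Γ → Γ ⊢ Δ ⊎ LeftCondition Γ Δ χ
    prove-or-leftCondition {var p} χ∈Γ with var p ∈? Δ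
    ... | yes χ∈Δ = inj₁ (⊢-via χ∈Γ ⊑-refl χ∈Δ)
    ... | no  χ∉Δ = inj₂ χ∉Δ
    prove-or-leftCondition {⊥′} χ∈Γ = inj₁ (⊑-trans (⋀-lower χ∈Γ) ⊥-min)
    prove-or-leftCondition {a ∧′ b} χ∈Γ
      with a∈S , b∈S ← components refl (Γ⊆S χ∈Γ)
      with total a∈S | total b∈S
    ... | inj₂ a∈Δ | _        = inj₁ (⊢-via χ∈Γ ∧-fst a∈Δ)
    ... | inj₁ _   | inj₂ b∈Δ = inj₁ (⊢-via χ∈Γ ∧-snd b∈Δ)
    ... | inj₁ a∈Γ | inj₁ b∈Γ = inj₂ (a∈Γ , b∈Γ)
    prove-or-leftCondition {a ∨′ b} χ∈Γ
      with a∈S , b∈S ← components refl (Γ⊆S χ∈Γ)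
      with total a∈S | total b∈S
    ... | inj₁ a∈Γ | _        = inj₂ (inj₁ a∈Γ)
    ... | inj₂ _   | inj₁ b∈Γ = inj₂ (inj₂ b∈Γ)
    ... | inj₂ a∈Δ | inj₂ b∈Δ =
      inj₁ (⊑-trans (⋀-lower χ∈Γ) (∨-case (⋁-upper a∈Δ) (⋁-upper b∈Δ)))
    prove-or-leftCondition {a ⇒′ b} χ∈Γ
      with a∈S , b∈S ← components refl (Γ⊆S χ∈Γ)
      with total a∈S | total b∈S
    ... | inj₂ a∈Δ | _        = inj₂ (inj₁ a∈Δ)
    ... | inj₁ _   | inj₁ b∈Γ = inj₂ (inj₂ b∈Γ)
    ... | inj₁ a∈Γ | inj₂ b∈Δ =
      inj₁ (⊑-trans (modusPonens (⋀-lower χ∈Γ) (⋀-lower a∈Γ)) (⋁-upper b∈Δ))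

    -- Only an implication can lead outside the pair; `next` is the search for its witness,
    -- restricted to `a` outside `Γ` so that the left side gains a formula.
    prove-or-rightCondition :
      (∀ {a b} → a ∈ S → b ∈ S → ¬ a ∈ Γ → a ∷ Γ ⊢ [ b ] ⊎ HintikkaExtension (a ∷ Γ) [ b ]) →
      χ ∈ Δ → Γ ⊢ Δ ⊎ RightCondition Hintikka Γ Δ χ
    prove-or-rightCondition {var p} next χ∈Δ = inj₂ _
    prove-or-rightCondition {⊥′} next χ∈Δ = inj₂ _
    prove-or-rightCondition {a ∧′ b} next χ∈Δ
      with a∈S , b∈S ← components refl (Δ⊆S χ∈Δ)
      with total a∈S | total b∈S
    ... | inj₂ a∈Δ | _        = inj₂ (inj₁ a∈Δ)
    ... | inj₁ _   | inj₂ b∈Δ = inj₂ (inj₂ b∈Δ)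
    ... | inj₁ a∈Γ | inj₁ b∈Γ =
      inj₁ (⊑-trans (∧-pair (⋀-lower a∈Γ) (⋀-lower b∈Γ)) (⋁-upper χ∈Δ))
    prove-or-rightCondition {a ∨′ b} next χ∈Δ
      with a∈S , b∈S ← components refl (Δ⊆S χ∈Δ)
      with total a∈S | total b∈S
    ... | inj₁ a∈Γ | _        = inj₁ (⊢-via a∈Γ ∨-inl χ∈Δ)
    ... | inj₂ _   | inj₁ b∈Γ = inj₁ (⊢-via b∈Γ ∨-inr χ∈Δ)
    ... | inj₂ a∈Δ | inj₂ b∈Δ = inj₂ (a∈Δ , b∈Δ)
    prove-or-rightCondition {a ⇒′ b} next χ∈Δ
      with a∈S , b∈S ← components refl (Δ⊆S χ∈Δ)
      -- `total` could report `a ∈ Δ` although `a ∈ Γ` holds too; deciding membership gives the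
      -- negative fact that `next` requires.
      with a ∈? Γ | total b∈S
    ... | _       | inj₁ b∈Γ = inj₁ (⊢-via b∈Γ (curry ∧-fst) χ∈Δ)
    ... | yes a∈Γ | inj₂ b∈Δ = inj₂ (inj₁ (a∈Γ , b∈Δ))
    ... | no  a∉Γ | inj₂ _
      with next a∈S b∈S a∉Γ
    ...   | inj₁ a,Γ⊢b = inj₁ (⇒-right {Γ = Γ} χ∈Δ a,Γ⊢b)
    ...   | inj₂ ext   = inj₂ (inj₂ ext)

  -- The list U bounds the subformulas that Γ can still acquire, and its length
  -- decreases whenever a refuted implication opens a new pair; xs lists the
  -- subformulas not yet placed in the current pair.
  prove-or-extend :
    ∀ U → Acc _<_ (length U) → (∀ {χ} → χ ∈ S → χ ∈ Γ ⊎ χ ∈ U) →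
    Γ ⊆ S → Δ ⊆ S →
    ∀ xs → xs ⊆ S → (∀ {χ} → χ ∈ S → χ ∈ xs ⊎ (χ ∈ Γ ⊎ χ ∈ Δ)) →
    Γ ⊢ Δ ⊎ HintikkaExtension Γ Δ
  prove-or-extend {Γ} {Δ} U wf bound Γ⊆S Δ⊆S (x ∷ xs) xs⊆S placed
    -- `x` is tried on both sides. Two derivations combine by `cut`; a Hintikka extension of either
    -- enlarged pair already extends the current one. `U` and `wf` stay fixed while `xs` shrinks.
    with prove-or-extend {x ∷ Γ} {Δ} U wf ([ inj₁ ∘ there , inj₂ ]′ ∘ bound)
           (∈-∷⁺ʳ (xs⊆S (here refl)) Γ⊆S) Δ⊆S xs (xs⊆S ∘ there)
           (λ χ∈S → [ (λ { (here refl) → inj₂ (inj₁ (here refl)) ; (there χ∈xs) → inj₁ χ∈xs })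
                    , inj₂ ∘ [ inj₁ ∘ there , inj₂ ]′ ]′ (placed χ∈S))
       | prove-or-extend {Γ} {x ∷ Δ} U wf bound
           Γ⊆S (∈-∷⁺ʳ (xs⊆S (here refl)) Δ⊆S) xs (xs⊆S ∘ there)
           (λ χ∈S → [ (λ { (here refl) → inj₂ (inj₂ (here refl)) ; (there χ∈xs) → inj₁ χ∈xs })
                    , inj₂ ∘ [ inj₁ , inj₂ ∘ there ]′ ]′ (placed χ∈S))
  ... | inj₁ p | inj₁ q = inj₁ (cut {Γ = Γ} {Δ} p q)
  ... | inj₂ (Γ′ , Δ′ , h , Γ⊆ , Δ⊆) | _ = inj₂ (Γ′ , Δ′ , h , Γ⊆ ∘ there , Δ⊆)
  ... | inj₁ _ | inj₂ (Γ′ , Δ′ , h , Γ⊆ , Δ⊆) = inj₂ (Γ′ , Δ′ , h , Γ⊆ , Δ⊆ ∘ there)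
  prove-or-extend {Γ} {Δ} U (acc rec) bound Γ⊆S Δ⊆S [] _ placed
    with all-or Γ (prove-or-leftCondition Γ⊆S Δ⊆S total)
       | all-or Δ (prove-or-rightCondition Γ⊆S Δ⊆S total next)
    where
    total : ∀ {χ} → χ ∈ S → χ ∈ Γ ⊎ χ ∈ Δ
    total χ∈S with inj₂ placed∈ ← placed χ∈S = placed∈

    next : ∀ {a b} → a ∈ S → b ∈ S → ¬ a ∈ Γ → a ∷ Γ ⊢ [ b ] ⊎ HintikkaExtension (a ∷ Γ) [ b ]
    next {a} {b} a∈S b∈S a∉Γ =
      -- As `a` is not in `Γ`, `bound` puts it in `U`; deleting it shortens `U`, which pays for
      -- placing all of `S` afresh.
      prove-or-extend (filter ≢a? U)
        (rec (filter-notAll ≢a? U (lose ([ ⊥-elim ∘ a∉Γ , id ]′ (bound a∈S)) (λ a≢a → a≢a refl))))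
        bound′ (∈-∷⁺ʳ a∈S Γ⊆S) (∈-∷⁺ʳ b∈S λ ()) S id inj₁
      where
      ≢a? = λ χ → ¬? (χ ≟ a)
      bound′ : ∀ {χ} → χ ∈ S → χ ∈ a ∷ Γ ⊎ χ ∈ filter ≢a? U
      bound′ {χ} χ∈S with χ ≟ a | bound χ∈S
      ... | yes χ≡a | _        = inj₁ (here χ≡a)
      ... | no  _   | inj₁ χ∈Γ = inj₁ (there χ∈Γ)
      ... | no  χ≢a | inj₂ χ∈U = inj₂ (∈-filter⁺ ≢a? χ∈U χ≢a)
  ... | inj₁ p  | _       = inj₁ p
  ... | inj₂ _  | inj₁ p  = inj₁ p
  ... | inj₂ ls | inj₂ rs = inj₂ (Γ , Δ , hintikka ls rs , id , id)

  prove-or-refute : ⊤′ ⊑ φ ⊎ HintikkaExtension [] [ φ ]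
  prove-or-refute
    -- The left side starts empty, so `U` must start as all of `S`.
    with prove-or-extend S (<-wellFounded _) inj₂ (λ ()) (∈-∷⁺ʳ (here refl) λ ()) S id inj₁
  ... | inj₁ p = inj₁ (⊑-trans p (∨-case ⊑-refl ⊥-min))
  ... | inj₂ h = inj₂ h

-- The model of Hintikka pairs

does-true : ∀ {A : Set} (A? : Dec A) → does A? ≡ true → A
does-true A? eq = invert (subst (Reflects _) eq (proof A?))

-- The order compares left sides only, since a witness for `a ⇒′ b` restarts its right side from
-- `[ b ]`. Decidable membership makes the valuation Boolean.
hintikkaModel : (w r : Level) → Hintikka Γ Δ → KripkeModel w r
hintikkaModel w r h = record
  { W          = Lift w (∃₂ Hintikka)
  ; point      = lift (_ , _ , h)
  ; R          = λ (lift (Γ , _)) (lift (Γ′ , _)) → Lift r (Γ ⊆ Γ′)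
  ; reflexive  = lift id
  ; transitive = λ (lift p) (lift q) → lift (q ∘ p)
  ; V          = λ p (lift (Γ , _)) → does (var p ∈? Γ)
  ; monotone   = λ p v (lift Γ⊆Γ′) → dec-true (var p ∈? _) (Γ⊆Γ′ (does-true (var p ∈? _) v))
  }

module _ {w r : Level} (h : Hintikka Γ Δ) where
  private
    M = hintikkaModel w r h
  open KripkeModel M using (W)

  left right : W → List Formula
  left  (lift (Γ , _))     = Γ
  right (lift (_ , Δ , _)) = Δ

  leftCondition : ∀ x → χ ∈ left x → LeftCondition (left x) (right x) χ
  leftCondition (lift (_ , _ , hintikka ls _)) = lookupAll ls

  rightCondition : ∀ x → χ ∈ right x → RightCondition Hintikka (left x) (right x) χ
  rightCondition (lift (_ , _ , hintikka _ rs)) = lookupAll rs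

  -- The two halves of the truth lemma need a simultaneous induction on the formula, because an
  -- implication on one side uses its antecedent on the other.
  left⇒forced   : ∀ φ x → φ ∈ left x → M , x ⊨ φ
  right⇒refuted : ∀ φ x → φ ∈ right x → ¬ (M , x ⊨ φ)

  left⇒forced (var p) x p∈Γ = lift (dec-true (var p ∈? left x) p∈Γ)
  left⇒forced ⊥′ x ⊥∈Γ = ⊥-elim (leftCondition x ⊥∈Γ)
  left⇒forced (a ∧′ b) x a∧b∈Γ with a∈Γ , b∈Γ ← leftCondition x a∧b∈Γ =
    left⇒forced a x a∈Γ , left⇒forced b x b∈Γ
  left⇒forced (a ∨′ b) x a∨b∈Γ = Sum.map (left⇒forced a x) (left⇒forced b x) (leftCondition x a∨b∈Γ)
  left⇒forced (a ⇒′ b) x a⇒b∈Γ y (lift Γ⊆) ⊨a with leftCondition y (Γ⊆ a⇒b∈Γ)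
  ... | inj₁ a∈Δ = ⊥-elim (right⇒refuted a y a∈Δ ⊨a)
  ... | inj₂ b∈Γ = left⇒forced b y b∈Γ

  right⇒refuted (var p) x p∈Δ (lift v) = leftCondition x (does-true (var p ∈? left x) v) p∈Δ
  right⇒refuted ⊥′ x _ = Poly.⊥-elim
  right⇒refuted (a ∧′ b) x a∧b∈Δ (⊨a , ⊨b) with rightCondition x a∧b∈Δ
  ... | inj₁ a∈Δ = right⇒refuted a x a∈Δ ⊨a
  ... | inj₂ b∈Δ = right⇒refuted b x b∈Δ ⊨b
  right⇒refuted (a ∨′ b) x a∨b∈Δ with a∈Δ , b∈Δ ← rightCondition x a∨b∈Δ =
    [ right⇒refuted a x a∈Δ , right⇒refuted b x b∈Δ ]′
  right⇒refuted (a ⇒′ b) x a⇒b∈Δ ⊨a⇒b with rightCondition x a⇒b∈Δ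
  ... | inj₁ (a∈Γ , b∈Δ) =
    right⇒refuted b x b∈Δ (⊨a⇒b x (lift id) (left⇒forced a x a∈Γ))
  ... | inj₂ (Γ′ , Δ′ , h′ , a,Γ⊆Γ′ , b⊆Δ′) =
    right⇒refuted b y (b⊆Δ′ (here refl))
      (⊨a⇒b y (lift (a,Γ⊆Γ′ ∘ there)) (left⇒forced a y (a,Γ⊆Γ′ (here refl))))
    where
    y = lift (Γ′ , Δ′ , h′)

-- Kripke completeness and the equivalence of the two semantics

kripkeCompleteness : ∀ {w r} φ → KripkeValid w r φ → ⊤′ ⊑ φ
kripkeCompleteness {w} {r} φ valid with prove-or-refute φ
... | inj₁ p = p
... | inj₂ (_ , _ , h , _ , φ⊆Δ) =
  ⊥-elim (right⇒refuted h φ (lift (_ , _ , h)) (φ⊆Δ (here refl)) (valid (hintikkaModel w r h) _))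

mainTheorem3 : (c ℓ₁ ℓ₂ w r : Level) (φ : Formula) →
    AlgebraicallyValid c ℓ₁ ℓ₂ φ ⇔ KripkeValid w r φ
mainTheorem3 c ℓ₁ ℓ₂ w r φ = mk⇔
  (kripkeSoundness φ ∘ algebraicCompleteness φ)
  (λ valid H I isInterpretation →
    algebraicSoundness H isInterpretation φ (kripkeCompleteness φ valid))
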